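{- Let $G=(U,V,E,\mathcal{A},E_{\mathcal{A}})$ be an attributed bipartite graph, $\alpha\in(0,1)$ a restart probability, $\beta\in[0,1]$ an attribute jumping probability, $u_i\in U$ a source node and $u_j\in U$ a target node. Then the AHPP score $\pi(u_i,u_j)$ equals the probability that the following random walk (the $\alpha$-attribute-augmented hidden random walk) starting from $u_i$ stops at $u_j$: (1) the walk starts at $u_i$; (2) at each step, the walker, being at the current node $u_k\in U$, stops at $u_k$ with probability $\alpha$, and with probability $1-\alpha$ it jumps to a node $u_l\in U$ according to the following rules: with probability $1-\beta$ it moves to $u_l$ according to the structure transition probability $\mathbf{P_S}[u_k,u_l]$, and with probability $\beta$ it moves to $u_l$ according to the attribute transition probability $\mathbf{P_A}[u_k,u_l]$.
   Context: **Attributed bipartite graph.** $G=(U,V,E,\mathcal{A},E_{\mathcal{A}})$: $U,V$ are disjoint finite node sets; $E$ is a set of edges $(x,v,w(x,v))$ with $x\in U$, $v\in V$ and positive weight $w(x,v)=w(v,x)$; $\mathcal{A}$ is a finite set of attributes; $E_{\mathcal{A}}$ is a set of node-attribute associations $(x,a,w(x,a))$ with $x\in U$, $a\in\mathcal{A}$ and positive weight $w(x,a)$. For a node $x\in U\cup V$, $N(x)$ is its set of neighbors in $E$ and $d(x)=\sum_{y\in N(x)}w(x,y)$. For $x\in U$, $\mathcal{A}(x)\subseteq\mathcal{A}$ is the set of attributes associated with $x$; for $a\in\mathcal{A}$, $\mathcal{A}^{ -1}(a)=\{x\in U: a\in\mathcal{A}(x)\}$. **AHPP score.** The structure transition matrix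 and the attribute transition matrix are the $|U|\times|U|$ matrices $$\mathbf{P_S}[u_i,u_j]=\sum_{v\in N(u_i)\cap N(u_j)}\frac{w(u_i,v)}{d(u_i)}\cdot\frac{w(v,u_j)}{d(v)},$$ $$\mathbf{P_A}[u_i,u_j]=\sum_{a\in\mathcal{A}(u_i)\cap\mathcal{A}(u_j)}\frac{w(u_i,a)}{\sum_{a_i\in\mathcal{A}(u_i)}w(u_i,a_i)}\cdot\frac{w(u_j,a)}{\sum_{u_k\in\mathcal{A}^{ -1}(a)}w(u_k,a)},$$ and $\mathbf{P}=(1-\beta)\mathbf{P_S}+\beta\mathbf{P_A}$. The AHPP (Attribute-augmented Hidden Personalized PageRank) score of $u_j$ with respect to $u_i$ is $\pi(u_i,u_j)=\sum_{\ell=0}^{\infty}\alpha(1-\alpha)^{\ell}\,\mathbf{P}^{\ell}[u_i,u_j]$. -}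

module Defs where

open import Level using (Level; 0ℓ; _⊔_) renaming (suc to lsuc)
open import Algebra.Apartness.Bundles using (HeytingCommutativeRing; HeytingField)
open import Data.Fin.Base using (Fin; zero; suc)
import Data.Fin.Properties as Fin
open import Data.List.Base using (List; []; _∷_; length)
open import Data.Nat.Base as ℕ using (ℕ; zero; suc)
open import Data.Product.Base using (Σ-syntax; ∃-syntax; _×_; _,_; proj₁)
open import Data.Sum.Base using (_⊎_; inj₁; inj₂; [_,_]′)
open import Data.Vec.Functional using (Vector; tail)
open import Function.Base using (_∘_; id)
open import Relation.Binary.Core using (REL; Rel)
open import Relation.Binary.Definitions using (Decidable)
open import Relation.Binary.PropositionalEquality.Core using (_≡_; _≢_)
open import Relation.Binary.Structures using (IsStrictPartialOrder)
open import Relation.Nullary.Decidable.Core using (Dec; yes; no; _×-dec_)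
open import Relation.Nullary.Negation.Core using (¬_; contradiction)
open import Relation.Unary using (Pred; _∩_; ∁; U; ∅; _≐_)

import Algebra.Definitions.RawSemiring as RawSemiringDefinitions
open import Algebra.Bundles using (CommutativeRing; Semiring)

-- The real numbers, axiomatised as a Cauchy-complete Archimedean ordered field.
-- Classically this determines ℝ up to isomorphism; cotransitivity of _<_
-- follows from that of _#_.
record RealField (c ℓ₁ ℓ₂ : Level) : Set (lsuc (c ⊔ ℓ₁ ⊔ ℓ₂)) where
  infix 4 _<_ _≤_

  field
    heytingField : HeytingField c ℓ₁ ℓ₂

  open HeytingField heytingField public hiding (zero)
  open HeytingCommutativeRing heytingCommutativeRing public
    using (commutativeRing)
  open CommutativeRing commutativeRing public
    using (semiring)
  open Semiring semiring public
    using (rawSemiring)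
  open RawSemiringDefinitions rawSemiring public
    using (sum; _^_) renaming (_×_ to _·_)

  field
    _<_                  : Rel Carrier ℓ₂
    <-isStrictPartialOrder : IsStrictPartialOrder _≈_ _<_
    #⇒<⊎>                : ∀ {x y} → x # y → x < y ⊎ y < x
    <⇒#                  : ∀ {x y} → x < y → x # y
    +-monoʳ-<            : ∀ x {y z} → y < z → x + y < x + z
    *-positive           : ∀ {x y} → 0# < x → 0# < y → 0# < x * y

  _≤_ : Rel Carrier ℓ₂
  x ≤ y = ¬ (y < x)

  _⟶_ : (ℕ → Carrier) → Carrier → Set (c ⊔ ℓ₂)
  s ⟶ x = ∀ {ε} → 0# < ε →
    ∃[ N ] ∀ n → N ℕ.≤ n → s n < x + ε × x < s n + ε

  IsCauchy : (ℕ → Carrier) → Set (c ⊔ ℓ₂)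
  IsCauchy s = ∀ {ε} → 0# < ε →
    ∃[ N ] ∀ m n → N ℕ.≤ m → N ℕ.≤ n → s m < s n + ε

  field
    archimedean : ∀ x → ∃[ n ] x < n · 1#
    complete    : ∀ s → IsCauchy s → ∃[ x ] s ⟶ x

  partialSum : (ℕ → Carrier) → ℕ → Carrier
  partialSum f zero    = 0#
  partialSum f (suc n) = partialSum f n + f n

  HasSum : (ℕ → Carrier) → Carrier → Set (c ⊔ ℓ₂)
  HasSum f x = partialSum f ⟶ x

  -- The library inverts differences of apart elements, so for y > 0 this is
  -- x times the inverse of y - 0#.
  _/_[_] : Carrier → (y : Carrier) → 0# < y → Carrier
  x / y [ 0<y ] = x * proj₁ (#⇒invertible (#-sym (<⇒# 0<y)))

  guard : ∀ {p} {P : Set p} → Dec P → (P → Carrier) → Carrier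
  guard (yes p) f = f p
  guard (no _)  f = 0#

module _ {c ℓ₁ ℓ₂ : Level} (ℝ : RealField c ℓ₁ ℓ₂) where
  open RealField ℝ
  private
    module < = IsStrictPartialOrder <-isStrictPartialOrder

    <-≤-trans : ∀ {x y z} → x < y → y ≤ z → x < z
    <-≤-trans {x} {y} {z} x<y y≤z with #-cotrans (<⇒# x<y) z
    ... | inj₁ x#z = [ id , (λ z<x → contradiction (<.trans z<x x<y) y≤z) ]′ (#⇒<⊎> x#z)
    ... | inj₂ z#y = [ (λ z<y → contradiction z<y y≤z) , <.trans x<y ]′ (#⇒<⊎> z#y)

    ≤-+-nonNegative : ∀ {x y} → 0# ≤ y → x ≤ x + y
    ≤-+-nonNegative {x} {y} 0≤y x+y<x = 0≤y
      (<.<-respˡ-≈ cancel (<.<-respʳ-≈ (-‿inverseˡ x) (+-monoʳ-< (- x) x+y<x)))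
      where
      cancel : - x + (x + y) ≈ y
      cancel = trans (sym (+-assoc (- x) x y))
        (trans (+-congʳ (-‿inverseˡ x)) (+-identityˡ y))

    +-positiveˡ : ∀ {x y} → 0# < x → 0# ≤ y → 0# < x + y
    +-positiveˡ 0<x 0≤y = <-≤-trans 0<x (≤-+-nonNegative 0≤y)

    +-nonNegative : ∀ {x y} → 0# ≤ x → 0# ≤ y → 0# ≤ x + y
    +-nonNegative 0≤x 0≤y x+y<0 =
      ≤-+-nonNegative 0≤y (<-≤-trans x+y<0 0≤x)

    guard-nonNegative : ∀ {p} {P : Set p} (P? : Dec P) {f : P → Carrier} →
                        (∀ p → 0# < f p) → 0# ≤ guard P? f
    guard-nonNegative (yes p) 0<f fp<0 = <.asym (0<f p) fp<0
    guard-nonNegative (no _)  0<f 0<0  = <.irrefl refl 0<0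

    guard-positive : ∀ {p} {P : Set p} (P? : Dec P) {f : P → Carrier} →
                     (∀ p → 0# < f p) → P → 0# < guard P? f
    guard-positive (yes p) 0<f _ = 0<f p
    guard-positive (no ¬p) 0<f p = contradiction p ¬p

    sum-nonNegative : ∀ {n} (f : Vector Carrier n) →
                      (∀ i → 0# ≤ f i) → 0# ≤ sum f
    sum-nonNegative {zero}  f 0≤f = <.irrefl refl
    sum-nonNegative {suc n} f 0≤f =
      +-nonNegative (0≤f zero) (sum-nonNegative (tail f) (0≤f ∘ suc))

    sum-positive : ∀ {n} (f : Vector Carrier n) → (∀ i → 0# ≤ f i) →
                   ∀ j → 0# < f j → 0# < sum f
    sum-positive f 0≤f zero    0<fj =
      +-positiveˡ 0<fj (sum-nonNegative (tail f) (0≤f ∘ suc))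
    sum-positive f 0≤f (suc j) 0<fj = <.<-respʳ-≈ (+-comm _ _)
      (+-positiveˡ (sum-positive (tail f) (0≤f ∘ suc) j 0<fj) (0≤f zero))

  sum-guard-positive : ∀ {n p} {P : Fin n → Set p} (P? : ∀ i → Dec (P i))
                       {f : ∀ i → P i → Carrier} → (∀ i p → 0# < f i p) →
                       ∀ j → P j → 0# < sum (λ i → guard (P? i) (f i))
  sum-guard-positive P? 0<f j p = sum-positive _
    (λ i → guard-nonNegative (P? i) (0<f i)) j (guard-positive (P? j) (0<f j) p)

module _ {c ℓ₁ ℓ₂ : Level} (ℝ : RealField c ℓ₁ ℓ₂) where
  open RealField ℝ

  -- weight i k is meaningful only when i ~ k.
  record WeightedRelation (m n : ℕ) : Set (lsuc 0ℓ ⊔ c ⊔ ℓ₂) where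
    infix 4 _~_ _~?_
    field
      _~_             : REL (Fin m) (Fin n) 0ℓ
      _~?_            : Decidable _~_
      weight          : Fin m → Fin n → Carrier
      weight-positive : ∀ {i k} → i ~ k → 0# < weight i k

    rowSum : Fin m → Carrier
    rowSum i = sum λ k → guard (i ~? k) λ _ → weight i k

    colSum : Fin n → Carrier
    colSum k = sum λ i → guard (i ~? k) λ _ → weight i k

    rowSum-positive : ∀ {i k} → i ~ k → 0# < rowSum i
    rowSum-positive {i} {k} =
      sum-guard-positive ℝ (i ~?_) (λ _ → weight-positive) k

    colSum-positive : ∀ {i k} → i ~ k → 0# < colSum k
    colSum-positive {i} {k} =
      sum-guard-positive ℝ (_~? k) (λ _ → weight-positive) i

    transition : Fin m → Fin m → Carrier
    transition i j = sum λ k → guard (i ~? k ×-dec j ~? k) λ (i~k , j~k) →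
      weight i k / rowSum i [ rowSum-positive i~k ] *
      weight j k / colSum k [ colSum-positive j~k ]

  -- U = Fin m, V = Fin n, 𝒜 = Fin k.  Since w(x,v) = w(v,x), each edge weight is
  -- stored once, and d is rowSum on U and colSum on V.
  record AttributedBipartiteGraph (m n k : ℕ) : Set (lsuc 0ℓ ⊔ c ⊔ ℓ₂) where
    field
      edges        : WeightedRelation m n
      associations : WeightedRelation m k

    P-S P-A : Fin m → Fin m → Carrier
    P-S = WeightedRelation.transition edges
    P-A = WeightedRelation.transition associations

  -- Classically, this is a σ-algebra with a probability measure.  The premise
  -- HasSum of σ-additive then always holds for some s, the partial sums being
  -- monotone and bounded by 1, so that σ-additive gives closure under countable
  -- disjoint (hence, with ∁ and ∩, all countable) unions and countable
  -- additivity.  Constructively, such sums need not converge.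
  record ProbabilitySpace (o e : Level) : Set (lsuc (o ⊔ e) ⊔ lsuc 0ℓ ⊔ c ⊔ ℓ₁ ⊔ ℓ₂) where
    field
      Ω          : Set o
      Measurable : Pred Ω 0ℓ → Set e

    Event : Set (o ⊔ e ⊔ lsuc 0ℓ)
    Event = ∃[ A ] Measurable A

    field
      measurable-resp-≐ : ∀ {A B} → A ≐ B → Measurable A → Measurable B
      U-measurable      : Measurable U
      ∅-measurable      : Measurable ∅
      ∁-measurable      : ∀ {A} → Measurable A → Measurable (∁ A)
      ∩-measurable      : ∀ {A B} → Measurable A → Measurable B → Measurable (A ∩ B)

      Pr             : Event → Carrier
      Pr-cong        : ∀ ((A , p) (B , q) : Event) → A ≐ B → Pr (A , p) ≈ Pr (B , q)
      Pr-nonNegative : ∀ A → 0# ≤ Pr A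
      Pr-U           : Pr (U , U-measurable) ≈ 1#
      Pr-∅           : Pr (∅ , ∅-measurable) ≈ 0#

      σ-additive : (A : ℕ → Event) →
        (∀ {i j} → i ≢ j → ∀ ω → ¬ (proj₁ (A i) ω × proj₁ (A j) ω)) →
        ∀ s → HasSum (λ n → Pr (A n)) s →
        Σ[ p ∈ Measurable (λ ω → ∃[ n ] proj₁ (A n) ω) ]
          Pr ((λ ω → ∃[ n ] proj₁ (A n) ω) , p) ≈ s

    _∩ᵉ_ : Event → Event → Event
    (A , p) ∩ᵉ (B , q) = A ∩ B , ∩-measurable p q

module _ {c ℓ₁ ℓ₂ : Level} {ℝ : RealField c ℓ₁ ℓ₂} where
  open RealField ℝ

  Matrix : ℕ → Set c
  Matrix m = Fin m → Fin m → Carrier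

  identity : ∀ {m} → Matrix m
  identity i j = guard (i Fin.≟ j) λ _ → 1#

  _⊗_ : ∀ {m} → Matrix m → Matrix m → Matrix m
  (M ⊗ N) i j = sum λ k → M i k * N k j

  power : ∀ {m} → Matrix m → ℕ → Matrix m
  power M zero    = identity
  power M (suc ℓ) = M ⊗ power M ℓ

  module _ {m n k : ℕ} (G : AttributedBipartiteGraph ℝ m n k) (α β : Carrier) where
    open AttributedBipartiteGraph G

    P : Matrix m
    P i j = (1# - β) * P-S i j + β * P-A i j

    -- π(i,j) exists and equals x.
    IsAHPPScore : Fin m → Fin m → Carrier → Set (c ⊔ ℓ₂)
    IsAHPPScore i j x = HasSum (λ ℓ → α * (1# - α) ^ ℓ * power P ℓ i j) x

data Mode : Set where
  structure attribute : Mode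

-- The outcome of one step of a walk on Fin m.  When the current node has no
-- edge (or no attribute) P-S (or P-A) has a zero row there, so the rules leave
-- some probability unassigned; this is the probability of being stuck, where
-- the walk ends without stopping at any node.
data Step (m : ℕ) : Set where
  stop  : Step m
  jump  : Mode → Fin m → Step m
  stuck : Step m

-- The jumps made so far, latest first.
History : ℕ → Set
History m = List (Mode × Fin m)

current : ∀ {m} → Fin m → History m → Fin m
current u []            = u
current u ((_ , v) ∷ _) = v

module _ {c ℓ₁ ℓ₂ o e : Level} {ℝ : RealField c ℓ₁ ℓ₂} where
  open RealField ℝ

  -- step t is meaningful only while all earlier steps are jumps.
  record StepProcess (m : ℕ) (S : ProbabilitySpace ℝ o e) : Set (o ⊔ e) where
    open ProbabilitySpace S

    field
      step            : ℕ → Ω → Step m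
      step-measurable : ∀ t s → Measurable (λ ω → step t ω ≡ s)

    steps : ℕ → Step m → Event
    steps t s = (λ ω → step t ω ≡ s) , step-measurable t s

    followed : History m → Event
    followed []            = U , U-measurable
    followed ((c , v) ∷ h) = followed h ∩ᵉ steps (length h) (jump c v)

  -- The α-attribute-augmented hidden random walk from u, realised on an
  -- arbitrary probability space.  Each law gives the conditional probability of
  -- the next step given the history so far, multiplied out to avoid dividing by
  -- the probability of the history.
  record HiddenRandomWalk {m n k : ℕ} (G : AttributedBipartiteGraph ℝ m n k)
      (α β : Carrier) (u : Fin m) (S : ProbabilitySpace ℝ o e)
      : Set (o ⊔ e ⊔ ℓ₁) where
    open AttributedBipartiteGraph G
    open ProbabilitySpace S

    field
      process : StepProcess m S

    open StepProcess process public

    field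
      stop-law : ∀ h →
        Pr (followed h ∩ᵉ steps (length h) stop) ≈ Pr (followed h) * α
      structure-law : ∀ h v →
        Pr (followed h ∩ᵉ steps (length h) (jump structure v)) ≈
        Pr (followed h) * ((1# - α) * ((1# - β) * P-S (current u h) v))
      attribute-law : ∀ h v →
        Pr (followed h ∩ᵉ steps (length h) (jump attribute v)) ≈
        Pr (followed h) * ((1# - α) * (β * P-A (current u h) v))

    StopsAt : Fin m → Pred Ω 0ℓ
    StopsAt v ω = ∃[ h ]
      proj₁ (followed h) ω × step (length h) ω ≡ stop × current u h ≡ v

module Submission where

-- The events "t jumps have been made and the walk is at v" are pairwise disjoint
-- for each t, and summing the step laws over the histories they consist of gives
-- them probability (1-α)ᵗ Pᵗ[u,v].  Hence the walk stops at v at time t with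
-- probability α(1-α)ᵗ Pᵗ[u,v], and the theorem is σ-additivity once this series is
-- known to converge.  Constructively, convergence needs a rate: the probability
-- of stopping at time t is at most the drop in the survival probability, so tails
-- of the series are bounded by the survival probability, which is at most (1-α)ᵗ.

open import Defs
open import Level using (Level; 0ℓ)
open import Algebra.Bundles using (CommutativeRing)
open import Data.Fin.Base using (Fin; zero; suc)
open import Data.List.Base using ([]; _∷_; length)
open import Data.Nat.Base as ℕ using (ℕ; zero; suc)
open import Data.Product.Base using (Σ-syntax; ∃-syntax; _×_; _,_; proj₁; proj₂)
open import Data.Sum.Base using (_⊎_; inj₁; inj₂; [_,_]′)
open import Data.Vec.Functional using (Vector)
open import Function.Base using (_∘_; id)
open import Relation.Binary.Core using (Rel)
open import Relation.Binary.Definitions using (tri<; tri≈; tri>)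
open import Relation.Binary.PropositionalEquality.Core as ≡ using (_≡_; _≢_)
open import Relation.Binary.Structures using (IsStrictPartialOrder; IsPreorder)
open import Relation.Nullary.Decidable.Core using (Dec; yes; no)
open import Relation.Nullary.Negation.Core using (¬_; contradiction)
open import Relation.Unary using (Pred; _∪_; U; ∅; _≐_; Empty)

import Algebra.Apartness.Properties.HeytingCommutativeRing as HeytingCommutativeRingProperties
import Algebra.Properties.CommutativeSemigroup as CommutativeSemigroupProperties
import Algebra.Properties.Semiring.Sum as SemiringSum
import Data.Fin.Properties as Fin
import Data.Nat.Properties as ℕ
import Relation.Binary.Reasoning.Base.Triple as TripleReasoning
import Relation.Binary.Reasoning.Setoid as SetoidReasoning

-- Consequences of the axioms of the ordered field.

module OrderProperties {c ℓ₁ ℓ₂ : Level} (ℝ : RealField c ℓ₁ ℓ₂) where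
  open RealField ℝ
  open HeytingCommutativeRingProperties heytingCommutativeRing using (x-0≈x)
  private module < = IsStrictPartialOrder <-isStrictPartialOrder

  <-cotrans : ∀ {x y} → x < y → ∀ z → x < z ⊎ z < y
  <-cotrans x<y z with #-cotrans (<⇒# x<y) z
  ... | inj₁ x#z = [ inj₁ , (λ z<x → inj₂ (<.trans z<x x<y)) ]′ (#⇒<⊎> x#z)
  ... | inj₂ z#y = [ inj₂ , (λ y<z → inj₁ (<.trans x<y y<z)) ]′ (#⇒<⊎> z#y)

  <⇒≤ : ∀ {x y} → x < y → x ≤ y
  <⇒≤ = <.asym

  ≤-reflexive : ∀ {x y} → x ≈ y → x ≤ y
  ≤-reflexive x≈y = <.irrefl (sym x≈y)

  ≤-refl : ∀ {x} → x ≤ x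
  ≤-refl = ≤-reflexive refl

  ≤-trans : ∀ {x y z} → x ≤ y → y ≤ z → x ≤ z
  ≤-trans {y = y} x≤y y≤z z<x = [ y≤z , x≤y ]′ (<-cotrans z<x y)

  <-≤-trans : ∀ {x y z} → x < y → y ≤ z → x < z
  <-≤-trans {z = z} x<y y≤z =
    [ id , (λ z<y → contradiction z<y y≤z) ]′ (<-cotrans x<y z)

  ≤-<-trans : ∀ {x y z} → x ≤ y → y < z → x < z
  ≤-<-trans {x} x≤y y<z =
    [ (λ y<x → contradiction y<x x≤y) , id ]′ (<-cotrans y<z x)

  ≤-isPreorder : IsPreorder _≈_ _≤_
  ≤-isPreorder = record
    { isEquivalence = isEquivalence
    ; reflexive     = ≤-reflexive
    ; trans         = ≤-trans
    }

  module ≤-Reasoning = TripleReasoning ≤-isPreorder <.asym <.trans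
    <.<-resp-≈ <⇒≤ <-≤-trans ≤-<-trans
  open ≤-Reasoning

  -x+[x+y]≈y : ∀ x y → - x + (x + y) ≈ y
  -x+[x+y]≈y x y = trans (sym (+-assoc (- x) x y))
    (trans (+-congʳ (-‿inverseˡ x)) (+-identityˡ y))

  +-cancelˡ-< : ∀ x {y z} → x + y < x + z → y < z
  +-cancelˡ-< x {y} {z} x+y<x+z = begin-strict
    y              ≈⟨ -x+[x+y]≈y x y ⟨
    - x + (x + y)  <⟨ +-monoʳ-< (- x) x+y<x+z ⟩
    - x + (x + z)  ≈⟨ -x+[x+y]≈y x z ⟩
    z              ∎

  -- Since `y ≤ z` denies `z < y`, monotonicity for `≤` is the contrapositive of cancellation for
  -- `<`, and cancellation for `≤` that of monotonicity for `<`.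
  +-monoʳ-≤ : ∀ x {y z} → y ≤ z → x + y ≤ x + z
  +-monoʳ-≤ x y≤z = y≤z ∘ +-cancelˡ-< x

  +-cancelˡ-≤ : ∀ x {y z} → x + y ≤ x + z → y ≤ z
  +-cancelˡ-≤ x x+y≤x+z = x+y≤x+z ∘ +-monoʳ-< x

  +-monoˡ-≤ : ∀ x {y z} → y ≤ z → y + x ≤ z + x
  +-monoˡ-≤ x {y} {z} y≤z = begin
    y + x  ≈⟨ +-comm y x ⟩
    x + y  ≤⟨ +-monoʳ-≤ x y≤z ⟩
    x + z  ≈⟨ +-comm x z ⟩
    z + x  ∎

  x≤x+y : ∀ x {y} → 0# ≤ y → x ≤ x + y
  x≤x+y x {y} 0≤y = begin
    x       ≈⟨ +-identityʳ x ⟨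
    x + 0#  ≤⟨ +-monoʳ-≤ x 0≤y ⟩
    x + y   ∎

  x≤y+x : ∀ x {y} → 0# ≤ y → x ≤ y + x
  x≤y+x x {y} 0≤y = ≤-trans (x≤x+y x 0≤y) (≤-reflexive (+-comm x y))

  x<y⇒0<-x+y : ∀ {x y} → x < y → 0# < - x + y
  x<y⇒0<-x+y {x} {y} x<y = begin-strict
    0#       ≈⟨ -‿inverseˡ x ⟨
    - x + x  <⟨ +-monoʳ-< (- x) x<y ⟩
    - x + y  ∎

  -- The axiom on products concerns positive factors, so it is applied to `x` and the difference
  -- `- y + z`; the common summand `x * - y` then cancels.
  *-monoˡ-< : ∀ {x y z} → 0# < x → y < z → x * y < x * z
  *-monoˡ-< {x} {y} {z} 0<x y<z = +-cancelˡ-< (x * - y) (begin-strict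
    x * - y + x * y    ≈⟨ distribˡ x (- y) y ⟨
    x * (- y + y)      ≈⟨ *-congˡ (-‿inverseˡ y) ⟩
    x * 0#             ≈⟨ zeroʳ x ⟩
    0#                 <⟨ *-positive 0<x (x<y⇒0<-x+y y<z) ⟩
    x * (- y + z)      ≈⟨ distribˡ x (- y) z ⟩
    x * - y + x * z    ∎)

  -- An invertible element is apart from zero, so `y` has a sign. If `y < 0#`, multiplying by `x`
  -- gives `1# < 0#`, and multiplying by `x` once more gives `x < 0#`.
  inverse-positive : ∀ {x} → 0# < x → ∃[ y ] 0# < y × y * x ≈ 1#
  inverse-positive {x} 0<x with #⇒invertible (#-sym (<⇒# 0<x))
  ... | y , y*[x-0]≈1 , [x-0]*y≈1 =
    y , [ (λ y<0 → contradiction (1<0⇒x<0 (1<0 y<0)) (<⇒≤ 0<x)) , id ]′ (#⇒<⊎> y#0) , y*x≈1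
    where
    y*x≈1 : y * x ≈ 1#
    y*x≈1 = trans (*-congˡ (sym (x-0≈x x))) y*[x-0]≈1

    x*y≈1 : x * y ≈ 1#
    x*y≈1 = trans (*-comm x y) y*x≈1

    y#0 : y # 0#
    y#0 = invertible⇒# (x , trans (*-congˡ (x-0≈x y)) x*y≈1 ,
                            trans (*-congʳ (x-0≈x y)) y*x≈1)

    1<0 : y < 0# → 1# < 0#
    1<0 y<0 = begin-strict
      1#      ≈⟨ x*y≈1 ⟨
      x * y   <⟨ *-monoˡ-< 0<x y<0 ⟩
      x * 0#  ≈⟨ zeroʳ x ⟩
      0#      ∎

    1<0⇒x<0 : 1# < 0# → x < 0#
    1<0⇒x<0 1<0 = begin-strict
      x       ≈⟨ *-identityʳ x ⟨
      x * 1#  <⟨ *-monoˡ-< 0<x 1<0 ⟩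
      x * 0#  ≈⟨ zeroʳ x ⟩
      0#      ∎

  *-cancelˡ-< : ∀ {x y z} → 0# < x → x * y < x * z → y < z
  *-cancelˡ-< {x} {y} {z} 0<x xy<xz with inverse-positive 0<x
  ... | x⁻¹ , 0<x⁻¹ , x⁻¹x≈1 = begin-strict
    y              ≈⟨ cancel y ⟨
    x⁻¹ * (x * y)  <⟨ *-monoˡ-< 0<x⁻¹ xy<xz ⟩
    x⁻¹ * (x * z)  ≈⟨ cancel z ⟩
    z              ∎
    where
    cancel : ∀ w → x⁻¹ * (x * w) ≈ w
    cancel w = trans (sym (*-assoc x⁻¹ x w))
      (trans (*-congʳ x⁻¹x≈1) (*-identityˡ w))

  *-monoˡ-≤ : ∀ {x y z} → 0# < x → y ≤ z → x * y ≤ x * z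
  *-monoˡ-≤ 0<x y≤z = y≤z ∘ *-cancelˡ-< 0<x

  -- Monotone sequences, geometric decay and convergence of series.

  antitone : (g : ℕ → Carrier) → (∀ n → g (suc n) ≤ g n) →
             ∀ {m n} → m ℕ.≤ n → g n ≤ g m
  antitone g g-step = go ∘ ℕ.≤⇒≤′
    where
    go : ∀ {m n} → m ℕ.≤′ n → g n ≤ g m
    go (ℕ.≤′-reflexive ≡.refl) = ≤-refl
    go (ℕ.≤′-step m≤n)         = ≤-trans (g-step _) (go m≤n)

  monotone : (g : ℕ → Carrier) → (∀ n → g n ≤ g (suc n)) →
             ∀ {m n} → m ℕ.≤ n → g m ≤ g n
  monotone g g-step = go ∘ ℕ.≤⇒≤′
    where
    go : ∀ {m n} → m ℕ.≤′ n → g m ≤ g n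
    go (ℕ.≤′-reflexive ≡.refl) = ≤-refl
    go (ℕ.≤′-step m≤n)         = ≤-trans (go m≤n) (g-step _)

  -- One-sided: for nonnegative `g` this is convergence to zero.
  EventuallySmall : (ℕ → Carrier) → Set _
  EventuallySmall g = ∀ {ε} → 0# < ε → ∃[ N ] ∀ n → N ℕ.≤ n → g n < ε

  module _ {α q : Carrier} (0<α : 0# < α) (0<q : 0# < q) (q+α≈1 : q + α ≈ 1#) where

    x≈q*x+α*x : ∀ x → x ≈ q * x + α * x
    x≈q*x+α*x x = trans (sym (*-identityˡ x))
      (trans (*-congʳ (sym q+α≈1)) (distribʳ x q α))

    0<1 : 0# < 1#
    0<1 = begin-strict
      0#      <⟨ 0<α ⟩
      α       ≈⟨ +-identityʳ α ⟨
      α + 0#  <⟨ +-monoʳ-< α 0<q ⟩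
      α + q   ≈⟨ +-comm α q ⟩
      q + α   ≈⟨ q+α≈1 ⟩
      1#      ∎

    q^n-positive : ∀ n → 0# < q ^ n
    q^n-positive zero    = 0<1
    q^n-positive (suc n) = *-positive 0<q (q^n-positive n)

    q^n-decreasing : ∀ n → q ^ suc n ≤ q ^ n
    q^n-decreasing n = begin
      q * q ^ n              ≤⟨ x≤x+y _ (<⇒≤ (*-positive 0<α (q^n-positive n))) ⟩
      q * q ^ n + α * q ^ n  ≈⟨ x≈q*x+α*x (q ^ n) ⟨
      q ^ n                  ∎

    -- n α qⁿ ≤ α q⁰ + ⋯ + α qⁿ⁻¹ = 1 - qⁿ.
    n·αq^n+q^n≤1 : ∀ n → n · 1# * (α * q ^ n) + q ^ n ≤ 1#
    n·αq^n+q^n≤1 zero = ≤-reflexive (trans (+-congʳ (zeroˡ _)) (+-identityˡ 1#))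
    n·αq^n+q^n≤1 (suc n) = begin
      (1# + n · 1#) * (α * q ^ suc n) + q ^ suc n
        ≤⟨ +-monoˡ-≤ _ (*-monoˡ-≤ 0<1+n (*-monoˡ-≤ 0<α (q^n-decreasing n))) ⟩
      (1# + n · 1#) * (α * q ^ n) + q ^ suc n
        ≈⟨ +-congʳ (trans (distribʳ _ _ _) (trans (+-comm _ _) (+-congˡ (*-identityˡ _)))) ⟩
      (n · 1# * (α * q ^ n) + α * q ^ n) + q ^ suc n
        ≈⟨ +-assoc _ _ _ ⟩
      n · 1# * (α * q ^ n) + (α * q ^ n + q ^ suc n)
        ≈⟨ +-congˡ (trans (+-comm _ _) (sym (x≈q*x+α*x (q ^ n)))) ⟩
      n · 1# * (α * q ^ n) + q ^ n
        ≤⟨ n·αq^n+q^n≤1 n ⟩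
      1# ∎
      where
      0≤n·1 : ∀ n → 0# ≤ n · 1#
      0≤n·1 zero    = ≤-refl
      0≤n·1 (suc n) = ≤-trans (<⇒≤ 0<1) (x≤x+y 1# (0≤n·1 n))

      0<1+n : 0# < 1# + n · 1#
      0<1+n = <-≤-trans 0<1 (x≤x+y 1# (0≤n·1 n))

    -- Once `N` exceeds the inverse of `α * ε`, the bound above gives `N α q^N ≤ 1 < N α ε`, and the
    -- factor `N α` cancels. Later powers are no larger.
    ^-eventuallySmall : EventuallySmall (q ^_)
    ^-eventuallySmall {ε} 0<ε with inverse-positive (*-positive 0<α 0<ε)
    ... | y , 0<y , y*[α*ε]≈1 with archimedean y
    ...   | N , y<N = N , λ n N≤n →
      ≤-<-trans (antitone (q ^_) q^n-decreasing N≤n) (*-cancelˡ-< 0<Nα Nαq^N<Nαε)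
      where
      0<Nα : 0# < N · 1# * α
      -- `N` is positive because it exceeds the positive inverse `y`.
      0<Nα = *-positive (<.trans 0<y y<N) 0<α

      Nαq^N<Nαε : N · 1# * α * q ^ N < N · 1# * α * ε
      Nαq^N<Nαε = begin-strict
        N · 1# * α * q ^ N            ≈⟨ *-assoc _ _ _ ⟩
        N · 1# * (α * q ^ N)          ≤⟨ x≤x+y _ (<⇒≤ (q^n-positive N)) ⟩
        N · 1# * (α * q ^ N) + q ^ N  ≤⟨ n·αq^n+q^n≤1 N ⟩
        1#                            ≈⟨ y*[α*ε]≈1 ⟨
        y * (α * ε)                   ≈⟨ *-comm _ _ ⟩
        α * ε * y                     <⟨ *-monoˡ-< (*-positive 0<α 0<ε) y<N ⟩
        α * ε * (N · 1#)              ≈⟨ *-comm _ _ ⟩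
        N · 1# * (α * ε)              ≈⟨ *-assoc _ _ _ ⟨
        N · 1# * α * ε                ∎

  -- `g n` bounds the tail after `n` terms: the partial sums `s` increase while `s + g` decreases,
  -- so `s m ≤ s n + g n` whichever of `m` and `n` is larger. This one-sided bound is enough, since
  -- `IsCauchy` ranges over both orders of the indices.
  telescoping-summable : (f g : ℕ → Carrier) → (∀ n → 0# ≤ f n) → (∀ n → 0# ≤ g n) →
    (∀ n → f n + g (suc n) ≤ g n) → EventuallySmall g → ∃[ x ] HasSum f x
  telescoping-summable f g 0≤f 0≤g f+g≤g g-small = complete s λ 0<ε →
    let N , g<ε = g-small 0<ε in
    N , λ m n _ N≤n → ≤-<-trans (s≤s+g m n) (+-monoʳ-< (s n) (g<ε n N≤n))
    where
    s : ℕ → Carrier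
    s = partialSum f

    s+g-decreasing : ∀ n → s (suc n) + g (suc n) ≤ s n + g n
    s+g-decreasing n = ≤-trans (≤-reflexive (+-assoc _ _ _)) (+-monoʳ-≤ (s n) (f+g≤g n))

    s≤s+g : ∀ m n → s m ≤ s n + g n
    s≤s+g m n with ℕ.≤-total m n
    ... | inj₁ m≤n = ≤-trans (monotone s (λ k → x≤x+y _ (0≤f k)) m≤n) (x≤x+y _ (0≤g n))
    ... | inj₂ n≤m = ≤-trans (x≤x+y _ (0≤g m))
                       (antitone (λ k → s k + g k) s+g-decreasing n≤m)

  partialSum-cong : ∀ {f g : ℕ → Carrier} → (∀ n → f n ≈ g n) →
                    ∀ n → partialSum f n ≈ partialSum g n
  partialSum-cong f≈g zero    = refl
  partialSum-cong f≈g (suc n) = +-cong (partialSum-cong f≈g n) (f≈g n)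

  HasSum-cong : ∀ {f g : ℕ → Carrier} {x y} → (∀ n → f n ≈ g n) → x ≈ y →
                HasSum f x → HasSum g y
  HasSum-cong {f} {g} {x} {y} f≈g x≈y f→x {ε} 0<ε with f→x 0<ε
  ... | N , close = N , λ n N≤n → let s<x+ε , x<s+ε = close n N≤n in
      (begin-strict
        partialSum g n      ≈⟨ partialSum-cong f≈g n ⟨
        partialSum f n      <⟨ s<x+ε ⟩
        x + ε               ≈⟨ +-congʳ x≈y ⟩
        y + ε               ∎)
    , (begin-strict
        y                   ≈⟨ x≈y ⟨
        x                   <⟨ x<s+ε ⟩
        partialSum f n + ε  ≈⟨ +-congʳ (partialSum-cong f≈g n) ⟩
        partialSum g n + ε  ∎)

  -- Serves to feed a finite sum, padded with zeros, to countable additivity.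
  eventuallyConstant-HasSum : ∀ (f : ℕ → Carrier) N {x} →
    (∀ n → partialSum f (N ℕ.+ n) ≈ x) → HasSum f x
  eventuallyConstant-HasSum f N {x} s≈x {ε} 0<ε = N , λ n N≤n →
    let s≈x′ = ≡.subst (λ k → partialSum f k ≈ x) (ℕ.m+[n∸m]≡n N≤n) (s≈x (n ℕ.∸ N)) in
    <.<-respˡ-≈ (sym s≈x′) (x<x+ε x) , <.<-respˡ-≈ s≈x′ (x<x+ε _)
    where
    x<x+ε : ∀ y → y < y + ε
    x<x+ε y = <.<-respˡ-≈ (+-identityʳ y) (+-monoʳ-< y 0<ε)

  sum-nonNegative : ∀ {n} (f : Vector Carrier n) → (∀ i → 0# ≤ f i) → 0# ≤ sum f
  sum-nonNegative {zero}  f 0≤f = ≤-refl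
  sum-nonNegative {suc n} f 0≤f =
    ≤-trans (sum-nonNegative (f ∘ suc) (0≤f ∘ suc)) (x≤y+x _ (0≤f zero))

  term≤sum : ∀ {n} (f : Vector Carrier n) → (∀ i → 0# ≤ f i) → ∀ i → f i ≤ sum f
  term≤sum f 0≤f zero    = x≤x+y _ (sum-nonNegative (f ∘ suc) (0≤f ∘ suc))
  term≤sum f 0≤f (suc i) =
    ≤-trans (term≤sum (f ∘ suc) (0≤f ∘ suc) i) (x≤y+x _ (0≤f zero))

-- Finite sums and matrix powers.

module MatrixProperties {c ℓ₁ ℓ₂ : Level} (ℝ : RealField c ℓ₁ ℓ₂) where
  open RealField ℝ
  open SemiringSum semiring
    using (sum-cong-≋; sum-replicate-zero; ∑-comm; *-distribˡ-sum; *-distribʳ-sum)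
  open SetoidReasoning setoid

  sum-zero : ∀ {n} (f : Vector Carrier n) → (∀ i → f i ≈ 0#) → sum f ≈ 0#
  sum-zero {n} f f≈0 = trans (sum-cong-≋ f≈0) (sum-replicate-zero n)

  sum-single : ∀ {n} (f : Vector Carrier n) i → (∀ j → i ≢ j → f j ≈ 0#) → sum f ≈ f i
  sum-single f zero f≈0 = trans (+-congˡ (sum-zero (f ∘ suc) λ j → f≈0 (suc j) λ ()))
    (+-identityʳ _)
  sum-single f (suc i) f≈0 = trans
    (+-cong (f≈0 zero λ ())
      (sum-single (f ∘ suc) i λ j i≢j → f≈0 (suc j) (i≢j ∘ Fin.suc-injective)))
    (+-identityˡ _)

  private
    I : ∀ {m} → Matrix {ℝ = ℝ} m
    I = identity {ℝ = ℝ}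

  identity-diagonal : ∀ {m} (i : Fin m) → I i i ≈ 1#
  identity-diagonal i with i Fin.≟ i
  ... | yes _  = refl
  ... | no i≢i = contradiction ≡.refl i≢i

  identity-offDiagonal : ∀ {m} {i j : Fin m} → i ≢ j → I i j ≈ 0#
  identity-offDiagonal {i = i} {j} i≢j with i Fin.≟ j
  ... | yes i≡j = contradiction i≡j i≢j
  ... | no _    = refl

  _⊛_ : ∀ {m} → Matrix {ℝ = ℝ} m → Matrix {ℝ = ℝ} m → Matrix {ℝ = ℝ} m
  _⊛_ = _⊗_ {ℝ = ℝ}

  ⊗-identityˡ : ∀ {m} (M : Matrix {ℝ = ℝ} m) i j → (I ⊛ M) i j ≈ M i j
  ⊗-identityˡ M i j = trans
    (sum-single _ i λ k i≢k → trans (*-congʳ (identity-offDiagonal i≢k)) (zeroˡ _))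
    (trans (*-congʳ (identity-diagonal i)) (*-identityˡ _))

  ⊗-identityʳ : ∀ {m} (M : Matrix {ℝ = ℝ} m) i j → (M ⊛ I) i j ≈ M i j
  ⊗-identityʳ M i j = trans
    (sum-single _ j λ k j≢k → trans (*-congˡ (identity-offDiagonal (j≢k ∘ ≡.sym))) (zeroʳ _))
    (trans (*-congˡ (identity-diagonal j)) (*-identityʳ _))

  ⊗-assoc : ∀ {m} (L M N : Matrix {ℝ = ℝ} m) i j →
            ((L ⊛ M) ⊛ N) i j ≈ (L ⊛ (M ⊛ N)) i j
  ⊗-assoc L M N i j = begin
    sum (λ k → sum (λ l → L i l * M l k) * N k j)
      ≈⟨ sum-cong-≋ (λ k → *-distribʳ-sum (N k j) (λ l → L i l * M l k)) ⟩
    sum (λ k → sum (λ l → L i l * M l k * N k j))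
      ≈⟨ ∑-comm (λ k l → L i l * M l k * N k j) ⟩
    sum (λ l → sum (λ k → L i l * M l k * N k j))
      ≈⟨ sum-cong-≋ (λ l → sum-cong-≋ (λ k → *-assoc (L i l) (M l k) (N k j))) ⟩
    sum (λ l → sum (λ k → L i l * (M l k * N k j)))
      ≈⟨ sum-cong-≋ (λ l → *-distribˡ-sum (L i l) (λ k → M l k * N k j)) ⟨
    sum (λ l → L i l * sum (λ k → M l k * N k j)) ∎

  -- `power` multiplies by `M` on the left, whereas the latest step of a walk contributes the
  -- rightmost factor.
  power-sucʳ : ∀ {m} (M : Matrix {ℝ = ℝ} m) ℓ i j →
               power {ℝ = ℝ} M (suc ℓ) i j ≈ (power {ℝ = ℝ} M ℓ ⊛ M) i j
  power-sucʳ M zero    i j = trans (⊗-identityʳ M i j) (sym (⊗-identityˡ M i j))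
  power-sucʳ M (suc ℓ) i j = begin
    (M ⊛ power {ℝ = ℝ} M (suc ℓ)) i j
      ≈⟨ sum-cong-≋ (λ k → *-congˡ (power-sucʳ M ℓ k j)) ⟩
    (M ⊛ (power {ℝ = ℝ} M ℓ ⊛ M)) i j
      ≈⟨ ⊗-assoc M (power {ℝ = ℝ} M ℓ) M i j ⟨
    ((M ⊛ power {ℝ = ℝ} M ℓ) ⊛ M) i j ∎

-- Finite additivity of probability.

module ProbabilityProperties {c ℓ₁ ℓ₂ o e : Level} (ℝ : RealField c ℓ₁ ℓ₂)
    (S : ProbabilitySpace ℝ o e) where
  open RealField ℝ
  open ProbabilitySpace S
  open OrderProperties ℝ using (eventuallyConstant-HasSum)

  ⟦_⟧ : Event → Pred Ω 0ℓ
  ⟦_⟧ = proj₁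

  ∅ᵉ Uᵉ : Event
  ∅ᵉ = ∅ , ∅-measurable
  Uᵉ = U , U-measurable

  Disjoint : Rel (Pred Ω 0ℓ) o
  Disjoint A B = ∀ ω → ¬ (A ω × B ω)

  Pr-empty : ∀ A → Empty ⟦ A ⟧ → Pr A ≈ 0#
  Pr-empty A A-empty = trans (Pr-cong A ∅ᵉ ((λ {ω} → A-empty ω) , λ ())) Pr-∅

  -- Countable additivity for the sequence `A`, `B`, `∅`, `∅`, and so on. Measurability comes out of
  -- the same application: complements and intersections alone give constructively only the double
  -- negation of the union.
  ∪-additive : ∀ A B → Disjoint ⟦ A ⟧ ⟦ B ⟧ →
    Σ[ p ∈ Measurable (⟦ A ⟧ ∪ ⟦ B ⟧) ] Pr (⟦ A ⟧ ∪ ⟦ B ⟧ , p) ≈ Pr A + Pr B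
  ∪-additive A B disjoint with σ-additive seq seq-disjoint _ seq-sum
    where
    seq : ℕ → Event
    seq 0             = A
    seq 1             = B
    seq (suc (suc _)) = ∅ᵉ

    seq-disjoint : ∀ {i j} → i ≢ j → Disjoint ⟦ seq i ⟧ ⟦ seq j ⟧
    seq-disjoint {0}           {0}           i≢j ω _         = i≢j ≡.refl
    seq-disjoint {0}           {1}           i≢j ω (a , b)   = disjoint ω (a , b)
    seq-disjoint {1}           {0}           i≢j ω (b , a)   = disjoint ω (a , b)
    seq-disjoint {1}           {1}           i≢j ω _         = i≢j ≡.refl
    seq-disjoint {_}           {suc (suc _)} i≢j ω (_ , ())
    seq-disjoint {suc (suc _)} {_}           i≢j ω (() , _)

    seq-sum : HasSum (Pr ∘ seq) (Pr A + Pr B)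
    seq-sum = eventuallyConstant-HasSum (Pr ∘ seq) 2 partial
      where
      partial : ∀ n → partialSum (Pr ∘ seq) (2 ℕ.+ n) ≈ Pr A + Pr B
      partial zero    = +-congʳ (+-identityˡ _)
      partial (suc n) = trans (+-cong (partial n) Pr-∅) (+-identityʳ _)
  ... | p , Pr≈ =
    measurable-resp-≐ union≐ p , trans (sym (Pr-cong (_ , p) _ union≐)) Pr≈
    where
    union≐ : _ ≐ (⟦ A ⟧ ∪ ⟦ B ⟧)
    union≐ = (λ { (0 , a) → inj₁ a ; (1 , b) → inj₂ b ; (suc (suc _) , ()) })
           , λ { (inj₁ a) → 0 , a ; (inj₂ b) → 1 , b }

  ⋃-additive : ∀ {n} (A : Fin n → Event) →
    (∀ {i j} → i ≢ j → Disjoint ⟦ A i ⟧ ⟦ A j ⟧) →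
    Σ[ p ∈ Measurable (λ ω → ∃[ i ] ⟦ A i ⟧ ω) ]
      Pr ((λ ω → ∃[ i ] ⟦ A i ⟧ ω) , p) ≈ sum (Pr ∘ A)
  ⋃-additive {zero}  A disjoint = measurable-resp-≐ ∅≐ ∅-measurable ,
    trans (sym (Pr-cong ∅ᵉ _ ∅≐)) Pr-∅
    where
    ∅≐ : ∅ ≐ (λ ω → ∃[ i ] ⟦ A i ⟧ ω)
    ∅≐ = (λ ()) , λ ()
  ⋃-additive {suc n} A disjoint
    with ⋃-additive (A ∘ suc) (λ i≢j → disjoint (i≢j ∘ Fin.suc-injective))
  ... | p , Pr-tail
    with ∪-additive (A zero) (_ , p) (λ { ω (a , i , b) → disjoint (λ ()) ω (a , b) })
  ...   | q , Pr-cons = measurable-resp-≐ cons≐ q ,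
    trans (sym (Pr-cong (_ , q) _ cons≐)) (trans Pr-cons (+-congˡ Pr-tail))
    where
    cons≐ : (⟦ A zero ⟧ ∪ (λ ω → ∃[ i ] ⟦ A (suc i) ⟧ ω)) ≐ (λ ω → ∃[ i ] ⟦ A i ⟧ ω)
    cons≐ = (λ { (inj₁ a) → zero , a ; (inj₂ (i , a)) → suc i , a })
          , λ { (zero , a) → inj₁ a ; (suc i , a) → inj₂ (i , a) }

  -- `Pr` formally depends on a measurability proof. By `Pr-cong` the event `C` may carry any such
  -- proof, not just the one constructed for the union.
  Pr-∪ : ∀ A B C → ⟦ C ⟧ ≐ (⟦ A ⟧ ∪ ⟦ B ⟧) → Disjoint ⟦ A ⟧ ⟦ B ⟧ → Pr C ≈ Pr A + Pr B
  Pr-∪ A B C C≐A∪B disjoint = let p , Pr≈ = ∪-additive A B disjoint in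
    trans (Pr-cong C (_ , p) C≐A∪B) Pr≈

  Pr-⋃ : ∀ {n} (A : Fin n → Event) C → ⟦ C ⟧ ≐ (λ ω → ∃[ i ] ⟦ A i ⟧ ω) →
         (∀ {i j} → i ≢ j → Disjoint ⟦ A i ⟧ ⟦ A j ⟧) → Pr C ≈ sum (Pr ∘ A)
  Pr-⋃ A C C≐⋃A disjoint = let p , Pr≈ = ⋃-additive A disjoint in
    trans (Pr-cong C (_ , p) C≐⋃A) Pr≈

-- Jumps and occupation probabilities of the walk.

module WalkProperties {c ℓ₁ ℓ₂ o e : Level} (ℝ : RealField c ℓ₁ ℓ₂)
    {m n k : ℕ} (G : AttributedBipartiteGraph ℝ m n k) (α β : RealField.Carrier ℝ)
    (u : Fin m) (S : ProbabilitySpace ℝ o e) (W : HiddenRandomWalk G α β u S) where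
  open RealField ℝ
  open ProbabilitySpace S
  open HiddenRandomWalk W
  open AttributedBipartiteGraph G using (P-S; P-A)
  open ProbabilityProperties ℝ S
  open MatrixProperties ℝ using (identity-diagonal; identity-offDiagonal; power-sucʳ)
  open SemiringSum semiring using (sum-cong-≋; *-distribˡ-sum; *-distribʳ-sum)
  open CommutativeSemigroupProperties
    (CommutativeRing.*-commutativeSemigroup commutativeRing)
    using () renaming (interchange to *-interchange)
  open SetoidReasoning setoid hiding (stop)

  private
    M : Matrix {ℝ = ℝ} m
    M = P G α β

    M^_ : ℕ → Matrix {ℝ = ℝ} m
    M^_ = power {ℝ = ℝ} M

  jump-injectiveʳ : ∀ {a b} {v w : Fin m} → jump a v ≡ jump b w → v ≡ w
  jump-injectiveʳ ≡.refl = ≡.refl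

  steps-disjoint : ∀ t {x y} → x ≢ y → Disjoint ⟦ steps t x ⟧ ⟦ steps t y ⟧
  steps-disjoint t x≢y ω (≡x , ≡y) = x≢y (≡.trans (≡.sym ≡x) ≡y)

  structure≢attribute : ∀ {v w : Fin m} → jump structure v ≢ jump attribute w
  structure≢attribute ()

  -- The mode is left open, to match `P`, which mixes the two transition matrices.
  JumpsTo : ℕ → Fin m → Pred Ω 0ℓ
  JumpsTo t v ω = ∃[ a ] step t ω ≡ jump a v

  JumpsTo≐ : ∀ t v → (⟦ steps t (jump structure v) ⟧ ∪ ⟦ steps t (jump attribute v) ⟧) ≐ JumpsTo t v
  JumpsTo≐ t v = (λ { (inj₁ eq) → structure , eq ; (inj₂ eq) → attribute , eq })
               , λ { (structure , eq) → inj₁ eq ; (attribute , eq) → inj₂ eq }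

  jumpsTo : ℕ → Fin m → Event
  jumpsTo t v = JumpsTo t v , measurable-resp-≐ (JumpsTo≐ t v)
    (proj₁ (∪-additive (steps t _) (steps t _) (steps-disjoint t structure≢attribute)))

  Pr-∩-jumpsTo : ∀ A t v → Pr (A ∩ᵉ jumpsTo t v) ≈
    Pr (A ∩ᵉ steps t (jump structure v)) + Pr (A ∩ᵉ steps t (jump attribute v))
  Pr-∩-jumpsTo A t v = Pr-∪ _ _ _
    ( (λ { (a , structure , eq) → inj₁ (a , eq) ; (a , attribute , eq) → inj₂ (a , eq) })
    , λ { (inj₁ (a , eq)) → a , structure , eq ; (inj₂ (a , eq)) → a , attribute , eq })
    λ { ω ((_ , eq) , (_ , eq′)) → steps-disjoint t structure≢attribute ω (eq , eq′) }

  -- The first `t` steps are all jumps and lead to `v`. Recursion on `t` makes this a finite union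
  -- over the previous node, with no enumeration of histories.
  At : ℕ → Fin m → Pred Ω 0ℓ
  At zero    v ω = u ≡ v
  At (suc t) v ω = ∃[ w ] At t w ω × JumpsTo t v ω

  At-unique : ∀ t {v w ω} → At t v ω → At t w ω → v ≡ w
  At-unique zero    u≡v u≡w = ≡.trans (≡.sym u≡v) u≡w
  At-unique (suc t) (_ , _ , _ , eq) (_ , _ , _ , eq′) =
    jump-injectiveʳ (≡.trans (≡.sym eq) eq′)

  at-measurable : ∀ t v → Measurable (At t v)
  -- `u ≡ v` does not depend on the outcome, so deciding it makes the event the whole space or the
  -- empty set.
  at-measurable zero v = decide (u Fin.≟ v)
    where
    decide : Dec (u ≡ v) → Measurable (λ _ → u ≡ v)
    decide (yes u≡v) = measurable-resp-≐ ((λ _ → u≡v) , _) U-measurable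
    decide (no u≢v)  = measurable-resp-≐ ((λ ()) , u≢v) ∅-measurable
  at-measurable (suc t) v = proj₁ (⋃-additive (λ w → (At t w , at-measurable t w) ∩ᵉ jumpsTo t v)
    λ w≢w′ ω ((p , _) , (q , _)) → w≢w′ (At-unique t p q))

  at : ℕ → Fin m → Event
  at t v = At t v , at-measurable t v

  Pr-at-suc : ∀ t v → Pr (at (suc t) v) ≈ sum λ w → Pr (at t w ∩ᵉ jumpsTo t v)
  Pr-at-suc t v = Pr-⋃ (λ w → at t w ∩ᵉ jumpsTo t v) _ (id , id)
    λ w≢w′ ω ((p , _) , (q , _)) → w≢w′ (At-unique t p q)

  -- Splits by the previous node and the mode of the last jump, and hands that jump over to the side
  -- event, so that `at t w` is left for an induction on `t`.
  Pr-at-suc-∩ : ∀ t v B → Pr (at (suc t) v ∩ᵉ B) ≈ sum λ w →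
    Pr (at t w ∩ᵉ (steps t (jump structure v) ∩ᵉ B)) +
    Pr (at t w ∩ᵉ (steps t (jump attribute v) ∩ᵉ B))
  Pr-at-suc-∩ t v B = begin
    Pr (at (suc t) v ∩ᵉ B)
      ≈⟨ Pr-⋃ (λ w → (at t w ∩ᵉ B) ∩ᵉ jumpsTo t v) _
           ( (λ { ((w , p , j) , b) → w , (p , b) , j })
           , λ { (w , (p , b) , j) → (w , p , j) , b })
           (λ w≢w′ ω (((p , _) , _) , ((q , _) , _)) → w≢w′ (At-unique t p q)) ⟩
    sum (λ w → Pr ((at t w ∩ᵉ B) ∩ᵉ jumpsTo t v))
      ≈⟨ sum-cong-≋ (λ w → trans (Pr-∩-jumpsTo (at t w ∩ᵉ B) t v)
           (+-cong (reassociate w _) (reassociate w _))) ⟩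
    sum (λ w → Pr (at t w ∩ᵉ (steps t (jump structure v) ∩ᵉ B)) +
               Pr (at t w ∩ᵉ (steps t (jump attribute v) ∩ᵉ B))) ∎
    where
    reassociate : ∀ w C → Pr ((at t w ∩ᵉ B) ∩ᵉ C) ≈ Pr (at t w ∩ᵉ (C ∩ᵉ B))
    reassociate w C = Pr-cong _ _
      ((λ { ((a , b) , c) → a , c , b }) , λ { (a , c , b) → (a , b) , c })

  -- The event at t v is the disjoint union of the followed h over the histories
  -- h of length t ending in v, so a law common to these histories sums up.
  at-law-∩ : ∀ t v B C q →
    (∀ h → length h ≡ t → current u h ≡ v →
      Pr (followed h ∩ᵉ B) ≈ Pr (followed h ∩ᵉ C) * q) →
    Pr (at t v ∩ᵉ B) ≈ Pr (at t v ∩ᵉ C) * q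
  at-law-∩ zero v B C q law = decide (u Fin.≟ v)
    where
    decide : Dec (u ≡ v) → Pr (at zero v ∩ᵉ B) ≈ Pr (at zero v ∩ᵉ C) * q
    decide (yes u≡v) = trans (at≈ B) (trans (law [] ≡.refl u≡v) (*-congʳ (sym (at≈ C))))
      where
      at≈ : ∀ D → Pr (at zero v ∩ᵉ D) ≈ Pr (Uᵉ ∩ᵉ D)
      at≈ D = Pr-cong _ _ ((λ (_ , d) → _ , d) , λ (_ , d) → u≡v , d)
    -- No history of length zero ends at `v`, so `law` says nothing here, but both sides are zero.
    decide (no u≢v) = trans (at≈0 B) (trans (sym (zeroˡ q)) (*-congʳ (sym (at≈0 C))))
      where
      at≈0 : ∀ D → Pr (at zero v ∩ᵉ D) ≈ 0#
      at≈0 D = Pr-empty _ λ ω (u≡v , _) → u≢v u≡v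
  at-law-∩ (suc t) v B C q law = begin
    Pr (at (suc t) v ∩ᵉ B)
      ≈⟨ Pr-at-suc-∩ t v B ⟩
    sum (λ w → Pr (at t w ∩ᵉ (steps t (jump structure v) ∩ᵉ B)) +
               Pr (at t w ∩ᵉ (steps t (jump attribute v) ∩ᵉ B)))
      ≈⟨ sum-cong-≋ (λ w → trans (+-cong (extend structure w) (extend attribute w))
           (sym (distribʳ q _ _))) ⟩
    sum (λ w → (Pr (at t w ∩ᵉ (steps t (jump structure v) ∩ᵉ C)) +
                Pr (at t w ∩ᵉ (steps t (jump attribute v) ∩ᵉ C))) * q)
      ≈⟨ *-distribʳ-sum q (λ w →
           Pr (at t w ∩ᵉ (steps t (jump structure v) ∩ᵉ C)) +
           Pr (at t w ∩ᵉ (steps t (jump attribute v) ∩ᵉ C))) ⟨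
    sum (λ w → Pr (at t w ∩ᵉ (steps t (jump structure v) ∩ᵉ C)) +
               Pr (at t w ∩ᵉ (steps t (jump attribute v) ∩ᵉ C))) * q
      ≈⟨ *-congʳ (Pr-at-suc-∩ t v C) ⟨
    Pr (at (suc t) v ∩ᵉ C) * q ∎
    where
    assoc : ∀ A B C → Pr (A ∩ᵉ (B ∩ᵉ C)) ≈ Pr ((A ∩ᵉ B) ∩ᵉ C)
    assoc A B C = Pr-cong _ _ ((λ (a , b , c) → (a , b) , c) , λ ((a , b) , c) → a , b , c)

    extend : ∀ a w → Pr (at t w ∩ᵉ (steps t (jump a v) ∩ᵉ B)) ≈
                     Pr (at t w ∩ᵉ (steps t (jump a v) ∩ᵉ C)) * q
    -- With the jump absorbed into both side events, the law required for `h` is the given law for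
    -- the longer history `(a , v) ∷ h`.
    extend a w = at-law-∩ t w _ _ q λ { h ≡.refl _ →
      trans (assoc (followed h) _ B) (trans (law ((a , v) ∷ h) ≡.refl ≡.refl)
        (*-congʳ (sym (assoc (followed h) _ C)))) }

  -- The case where `C` is the whole space. A general `C` is what the induction needs, as it
  -- collects the jumps peeled off the histories.
  at-law : ∀ t v B q →
    (∀ h → length h ≡ t → current u h ≡ v → Pr (followed h ∩ᵉ B) ≈ Pr (followed h) * q) →
    Pr (at t v ∩ᵉ B) ≈ Pr (at t v) * q
  at-law t v B q law = trans
    (at-law-∩ t v B Uᵉ q λ h len cur → trans (law h len cur) (*-congʳ (sym (∩-U (followed h)))))
    (*-congʳ (∩-U (at t v)))
    where
    ∩-U : ∀ A → Pr (A ∩ᵉ Uᵉ) ≈ Pr A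
    ∩-U A = Pr-cong _ _ (proj₁ , λ a → a , _)

  Pr-at-stop : ∀ t v → Pr (at t v ∩ᵉ steps t stop) ≈ Pr (at t v) * α
  Pr-at-stop t v = at-law t v _ α λ { h ≡.refl _ → stop-law h }

  -- Markov property: the step laws depend on the history only through its current node, and adding
  -- the two modes gives one step of the matrix `(1 - α) P`.
  Pr-at-jumpsTo : ∀ t w v → Pr (at t w ∩ᵉ jumpsTo t v) ≈ Pr (at t w) * ((1# - α) * M w v)
  Pr-at-jumpsTo t w v = at-law t w _ _ λ { h ≡.refl ≡.refl → begin
    Pr (followed h ∩ᵉ jumpsTo (length h) v)
      ≈⟨ Pr-∩-jumpsTo (followed h) (length h) v ⟩
    Pr (followed h ∩ᵉ steps (length h) (jump structure v)) +
    Pr (followed h ∩ᵉ steps (length h) (jump attribute v))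
      ≈⟨ +-cong (structure-law h v) (attribute-law h v) ⟩
    Pr (followed h) * ((1# - α) * ((1# - β) * P-S (current u h) v)) +
    Pr (followed h) * ((1# - α) * (β * P-A (current u h) v))
      ≈⟨ distribˡ _ _ _ ⟨
    Pr (followed h) * ((1# - α) * ((1# - β) * P-S (current u h) v) +
                       (1# - α) * (β * P-A (current u h) v))
      ≈⟨ *-congˡ (distribˡ _ _ _) ⟨
    Pr (followed h) * ((1# - α) * M (current u h) v) ∎ }

  -- Forward equation: splitting by the node before the last jump multiplies the row of occupation
  -- probabilities by `(1 - α) P` on the right.
  Pr-at : ∀ t v → Pr (at t v) ≈ (1# - α) ^ t * (M^ t) u v
  Pr-at zero v = trans (decide (u Fin.≟ v)) (sym (*-identityˡ _))
    where
    decide : Dec (u ≡ v) → Pr (at zero v) ≈ identity {ℝ = ℝ} u v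
    decide (yes ≡.refl) = trans (Pr-cong _ Uᵉ (_ , λ _ → ≡.refl))
      (trans Pr-U (sym (identity-diagonal u)))
    decide (no u≢v) = trans (Pr-empty _ λ _ → u≢v) (sym (identity-offDiagonal u≢v))
  Pr-at (suc t) v = begin
    Pr (at (suc t) v)
      ≈⟨ Pr-at-suc t v ⟩
    sum (λ w → Pr (at t w ∩ᵉ jumpsTo t v))
      ≈⟨ sum-cong-≋ (λ w → trans (Pr-at-jumpsTo t w v) (*-congʳ (Pr-at t w))) ⟩
    sum (λ w → (1# - α) ^ t * (M^ t) u w * ((1# - α) * M w v))
      ≈⟨ sum-cong-≋ (λ w → trans
           (*-interchange ((1# - α) ^ t) ((M^ t) u w) (1# - α) (M w v))
           (*-congʳ (*-comm ((1# - α) ^ t) (1# - α)))) ⟩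
    sum (λ w → (1# - α) ^ suc t * ((M^ t) u w * M w v))
      ≈⟨ *-distribˡ-sum ((1# - α) ^ suc t) (λ w → (M^ t) u w * M w v) ⟨
    (1# - α) ^ suc t * sum (λ w → (M^ t) u w * M w v)
      ≈⟨ *-congˡ (power-sucʳ M t u v) ⟨
    (1# - α) ^ suc t * (M^ suc t) u v ∎

  -- Survival of the walk.

  Alive : ℕ → Pred Ω 0ℓ
  Alive t ω = ∃[ v ] At t v ω

  alive : ℕ → Event
  alive t = Alive t , proj₁ (⋃-additive (at t) λ v≢w ω (p , q) → v≢w (At-unique t p q))

  Pr-alive : ∀ t → Pr (alive t) ≈ sum (λ v → Pr (at t v))
  Pr-alive t = Pr-⋃ (at t) _ (id , id) λ v≢w ω (p , q) → v≢w (At-unique t p q)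

  Pr-alive-stop-sum : ∀ t → Pr (alive t ∩ᵉ steps t stop) ≈ sum λ v → Pr (at t v ∩ᵉ steps t stop)
  Pr-alive-stop-sum t = Pr-⋃ (λ v → at t v ∩ᵉ steps t stop) _
    ((λ { ((v , p) , eq) → v , p , eq }) , λ { (v , p , eq) → (v , p) , eq })
    λ v≢w ω ((p , _) , (q , _)) → v≢w (At-unique t p q)

  Pr-alive-stop : ∀ t → Pr (alive t ∩ᵉ steps t stop) ≈ α * Pr (alive t)
  Pr-alive-stop t = begin
    Pr (alive t ∩ᵉ steps t stop)                ≈⟨ Pr-alive-stop-sum t ⟩
    sum (λ v → Pr (at t v ∩ᵉ steps t stop))     ≈⟨ sum-cong-≋ (Pr-at-stop t) ⟩
    sum (λ v → Pr (at t v) * α)                 ≈⟨ *-distribʳ-sum α (λ v → Pr (at t v)) ⟨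
    sum (λ v → Pr (at t v)) * α                 ≈⟨ *-congʳ (Pr-alive t) ⟨
    Pr (alive t) * α                            ≈⟨ *-comm _ _ ⟩
    α * Pr (alive t)                            ∎

  -- The summands are the three outcomes of step `t`: for a walk alive at time `t`, making a jump is
  -- the same as being alive at time `t + 1`.
  Pr-alive-split : ∀ t → Pr (alive t) ≈
    Pr (alive t ∩ᵉ steps t stop) + (Pr (alive (suc t)) + Pr (alive t ∩ᵉ steps t stuck))
  Pr-alive-split t = begin
    Pr (alive t)
      ≈⟨ Pr-∪ _ survives _ split stop∩survives ⟩
    Pr (alive t ∩ᵉ steps t stop) + Pr survives
      ≈⟨ +-congˡ (Pr-∪ _ _ _ (id , id) jumped∩stuck) ⟩
    Pr (alive t ∩ᵉ steps t stop) + (Pr (alive (suc t)) + Pr (alive t ∩ᵉ steps t stuck)) ∎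
    where
    jumped∩stuck : Disjoint (Alive (suc t)) ⟦ alive t ∩ᵉ steps t stuck ⟧
    jumped∩stuck ω ((_ , _ , _ , _ , eq) , (_ , eq′)) = steps-disjoint t (λ ()) ω (eq , eq′)

    survives : Event
    survives = (Alive (suc t) ∪ ⟦ alive t ∩ᵉ steps t stuck ⟧) ,
      proj₁ (∪-additive (alive (suc t)) (alive t ∩ᵉ steps t stuck) jumped∩stuck)

    stop∩survives : Disjoint ⟦ alive t ∩ᵉ steps t stop ⟧ ⟦ survives ⟧
    stop∩survives ω ((_ , eq) , inj₁ (_ , _ , _ , _ , eq′)) = steps-disjoint t (λ ()) ω (eq , eq′)
    stop∩survives ω ((_ , eq) , inj₂ (_ , eq′))             = steps-disjoint t (λ ()) ω (eq , eq′)

    split : Alive t ≐ (⟦ alive t ∩ᵉ steps t stop ⟧ ∪ ⟦ survives ⟧)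
    split = classify , λ { (inj₁ (p , _))                      → p
                         ; (inj₂ (inj₁ (_ , w , p , _)))       → w , p
                         ; (inj₂ (inj₂ (p , _)))               → p }
      where
      classify : ∀ {ω} → Alive t ω → (⟦ alive t ∩ᵉ steps t stop ⟧ ∪ ⟦ survives ⟧) ω
      -- `Step` is a data type, so its value at `ω` can be matched on constructively; the equation
      -- is kept as the evidence of the outcome.
      classify {ω} (w , p) = cases (step t ω) ≡.refl
        where
        cases : ∀ x → step t ω ≡ x → (⟦ alive t ∩ᵉ steps t stop ⟧ ∪ ⟦ survives ⟧) ω
        cases stop       eq = inj₁ ((w , p) , eq)
        cases (jump a v) eq = inj₂ (inj₁ (v , w , p , a , eq))
        cases stuck      eq = inj₂ (inj₂ ((w , p) , eq))

  -- Histories and the stopping event.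

  followed⇒At : ∀ h {ω} → ⟦ followed h ⟧ ω → At (length h) (current u h) ω
  followed⇒At []            _        = ≡.refl
  followed⇒At ((a , v) ∷ h) (f , eq) = current u h , followed⇒At h f , a , eq

  -- The mode of each jump is a witness inside `At`, and collecting these witnesses rebuilds a
  -- history.
  At⇒followed : ∀ t {v ω} → At t v ω →
    ∃[ h ] length h ≡ t × ⟦ followed h ⟧ ω × current u h ≡ v
  At⇒followed zero    u≡v = [] , ≡.refl , _ , u≡v
  At⇒followed (suc t) {v} (w , p , a , eq) with At⇒followed t p
  ... | h , ≡.refl , f , _ = (a , v) ∷ h , ≡.refl , (f , eq) , ≡.refl

  -- Grouping the stopping histories by length turns a union over histories into a union over times,
  -- to which countable additivity applies.
  StopsAt≐ : ∀ v → (λ ω → ∃[ t ] ⟦ at t v ∩ᵉ steps t stop ⟧ ω) ≐ StopsAt v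
  StopsAt≐ v = to , λ { (h , f , eq , ≡.refl) → length h , followed⇒At h f , eq }
    where
    to : ∀ {ω} → (∃[ t ] ⟦ at t v ∩ᵉ steps t stop ⟧ ω) → StopsAt v ω
    to (t , p , eq) with At⇒followed t p
    ... | h , ≡.refl , f , cur = h , f , eq , cur

  -- Makes the stopping times exclusive: a `stop` at time `s` contradicts the jump that being at a
  -- node at any later time requires.
  At⇒jumped : ∀ {s t v ω} → s ℕ.< t → At t v ω → ∃[ w ] JumpsTo s w ω
  At⇒jumped {s} {suc t} {v} s<1+t (w , p , jumps) with ℕ.m<1+n⇒m<n∨m≡n s<1+t
  ... | inj₁ s<t    = At⇒jumped s<t p
  ... | inj₂ ≡.refl = v , jumps

  stop-disjoint : ∀ v {s t} → s ≢ t →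
    Disjoint ⟦ at s v ∩ᵉ steps s stop ⟧ ⟦ at t v ∩ᵉ steps t stop ⟧
  stop-disjoint v {s} {t} s≢t ω ((p , eq) , (q , eq′)) with ℕ.<-cmp s t
  ... | tri≈ _ s≡t _ = s≢t s≡t
  ... | tri< s<t _ _ with At⇒jumped s<t q
  ...   | _ , _ , eq″ = steps-disjoint s (λ ()) ω (eq , eq″)
  stop-disjoint v {s} {t} s≢t ω ((p , eq) , (q , eq′)) | tri> _ _ t<s with At⇒jumped t<s p
  ...   | _ , _ , eq″ = steps-disjoint t (λ ()) ω (eq′ , eq″)

  -- Convergence is a premise of `σ-additive`, so the sum `x` has to be supplied; the survival
  -- bounds below provide it.
  StopsAt-hasPr : ∀ v x → HasSum (λ t → Pr (at t v ∩ᵉ steps t stop)) x →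
    Σ[ p ∈ Measurable (StopsAt v) ] Pr (StopsAt v , p) ≈ x
  StopsAt-hasPr v x hasSum
    with σ-additive (λ t → at t v ∩ᵉ steps t stop) (stop-disjoint v) x hasSum
  ... | p , Pr≈x = measurable-resp-≐ (StopsAt≐ v) p ,
    trans (sym (Pr-cong (_ , p) _ (StopsAt≐ v))) Pr≈x

  Pr-at-stop-score : ∀ t v → Pr (at t v ∩ᵉ steps t stop) ≈ α * (1# - α) ^ t * (M^ t) u v
  Pr-at-stop-score t v = begin
    Pr (at t v ∩ᵉ steps t stop)         ≈⟨ Pr-at-stop t v ⟩
    Pr (at t v) * α                     ≈⟨ *-congʳ (Pr-at t v) ⟩
    (1# - α) ^ t * (M^ t) u v * α       ≈⟨ *-comm _ _ ⟩
    α * ((1# - α) ^ t * (M^ t) u v)     ≈⟨ *-assoc _ _ _ ⟨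
    α * (1# - α) ^ t * (M^ t) u v       ∎

-- Convergence of the series of stopping probabilities.

module StopSeries {c ℓ₁ ℓ₂ o e : Level} (ℝ : RealField c ℓ₁ ℓ₂)
    {m n k : ℕ} (G : AttributedBipartiteGraph ℝ m n k) (α β : RealField.Carrier ℝ)
    (0<α : RealField._<_ ℝ (RealField.0# ℝ) α) (α<1 : RealField._<_ ℝ α (RealField.1# ℝ))
    (u : Fin m) (S : ProbabilitySpace ℝ o e) (W : HiddenRandomWalk G α β u S) where
  open RealField ℝ
  open ProbabilitySpace S
  open HiddenRandomWalk W
  open ProbabilityProperties ℝ S using (Uᵉ)
  open WalkProperties ℝ G α β u S W
  open OrderProperties ℝ
  open ≤-Reasoning hiding (stop)
  private module < = IsStrictPartialOrder <-isStrictPartialOrder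

  private
    q : Carrier
    q = 1# - α

    q+α≈1 : q + α ≈ 1#
    q+α≈1 = trans (+-assoc _ _ _) (trans (+-congˡ (-‿inverseˡ α)) (+-identityʳ 1#))

    0<q : 0# < q
    0<q = <.<-respʳ-≈ (+-comm _ _) (x<y⇒0<-x+y α<1)

  -- An inequality because the probability of getting stuck is dropped.
  alive-step : ∀ t → Pr (alive t ∩ᵉ steps t stop) + Pr (alive (suc t)) ≤ Pr (alive t)
  alive-step t = ≤-trans (+-monoʳ-≤ _ (x≤x+y _ (Pr-nonNegative _)))
    (≤-reflexive (sym (Pr-alive-split t)))

  -- Stopping takes exactly the share `α` of the survival probability, which leaves at most the
  -- share `q` for the jumps.
  Pr-alive-suc : ∀ t → Pr (alive (suc t)) ≤ q * Pr (alive t)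
  Pr-alive-suc t = +-cancelˡ-≤ (α * Pr (alive t)) (begin
    α * Pr (alive t) + Pr (alive (suc t))                ≈⟨ +-congʳ (Pr-alive-stop t) ⟨
    Pr (alive t ∩ᵉ steps t stop) + Pr (alive (suc t))    ≤⟨ alive-step t ⟩
    Pr (alive t)                                         ≈⟨ x≈q*x+α*x 0<α 0<q q+α≈1 _ ⟩
    q * Pr (alive t) + α * Pr (alive t)                  ≈⟨ +-comm _ _ ⟩
    α * Pr (alive t) + q * Pr (alive t)                  ∎)

  Pr-alive≤q^t : ∀ t → Pr (alive t) ≤ q ^ t
  Pr-alive≤q^t zero    = ≤-reflexive (trans (Pr-cong _ Uᵉ (_ , λ _ → u , ≡.refl)) Pr-U)
  Pr-alive≤q^t (suc t) = ≤-trans (Pr-alive-suc t) (*-monoˡ-≤ 0<q (Pr-alive≤q^t t))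

  stop-summable : ∀ v → ∃[ x ] HasSum (λ t → Pr (at t v ∩ᵉ steps t stop)) x
  stop-summable v = telescoping-summable _ (Pr ∘ alive)
    (λ t → Pr-nonNegative _) (λ t → Pr-nonNegative _)
    -- Stopping at `v` is at most as likely as stopping anywhere, which is at most the drop in
    -- survival.
    (λ t → ≤-trans (+-monoˡ-≤ _ (at-stop≤alive-stop t)) (alive-step t))
    λ 0<ε → let N , q^t<ε = ^-eventuallySmall 0<α 0<q q+α≈1 0<ε in
      N , λ t N≤t → ≤-<-trans (Pr-alive≤q^t t) (q^t<ε t N≤t)
    where
    at-stop≤alive-stop : ∀ t → Pr (at t v ∩ᵉ steps t stop) ≤ Pr (alive t ∩ᵉ steps t stop)
    at-stop≤alive-stop t = ≤-trans (term≤sum _ (λ w → Pr-nonNegative _) v)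
      (≤-reflexive (sym (Pr-alive-stop-sum t)))

lemma1 : {c ℓ₁ ℓ₂ o e : Level} (ℝ : RealField c ℓ₁ ℓ₂) →
    let open RealField ℝ in
    {m n k : ℕ} (G : AttributedBipartiteGraph ℝ m n k)
    (α β : Carrier) → 0# < α → α < 1# → 0# ≤ β → β ≤ 1# →
    (uᵢ uⱼ : Fin m)
    (S : ProbabilitySpace ℝ o e) (W : HiddenRandomWalk G α β uᵢ S) →
    let open ProbabilitySpace S
        open HiddenRandomWalk W in
    Σ[ p ∈ Measurable (StopsAt uⱼ) ] IsAHPPScore G α β uᵢ uⱼ (Pr (StopsAt uⱼ , p))
lemma1 ℝ G α β 0<α α<1 _ _ uᵢ uⱼ S W =
  let x , hasSum = stop-summable uⱼ
      p , Pr≈x   = StopsAt-hasPr uⱼ x hasSum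
  -- One limit serves both sides: it is the probability of the stopping event by additivity, and the
  -- score because the two series agree term by term.
  in p , HasSum-cong (λ t → Pr-at-stop-score t uⱼ) (sym Pr≈x) hasSum
  where
  open RealField ℝ using (sym)
  open OrderProperties ℝ using (HasSum-cong)
  open WalkProperties ℝ G α β uᵢ S W
  open StopSeries ℝ G α β 0<α α<1 uᵢ S W
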